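{- Fix $s,t\in\mathbb N\cup\{\infty\}$ and an instance $(G,\pi)$ with $G=(L,R,E)$. Let $\mathcal A$ be any SP-Greedy algorithm for $\mathrm{OMP}_3(s,t)$ and let $M$ be the final matching produced by $\mathcal A$ on $(G,\pi)$. Then for every edge $xy\in M$ (with $x\in L$, $y\in R$), if neither endpoint is exhausted (equivalently, if $xy$ is not frozen), the edge $xy$ cannot be the middle edge of an augmenting path of length $3$ for $M$. Equivalently, at least one of $x$ or $y$ has no free neighbor with respect to $M$.
   Context: Online bipartite matching: an instance $(G,\pi)$ is a finite bipartite graph $G=(L,R,E)$ and an arrival order $\pi$ of $R$. The offline side $L$ is known in advance; online vertices $j\in R$ arrive one by one in order $\pi$, and upon arrival of $j$ all edges incident to $j$ are revealed. The algorithm maintains a matching, initially empty. A vertex is free if it is unmatched. $\mathrm{OMP}_3(s,t)$: upon arrival of $j$, the algorithm either leaves $j$ unmatched (forever, unless matched at this moment) or augments the current matching $M'$ along an augmenting path of length $1$ or $3$ that starts at $j$ and ends at a free vertex of $L$. A length-1 path $[j~i]$ adds $ji$ with $i\in L$ free. A length-3 path $[j~x~y~i]$, with $x,i\in L$, $y\in R$, $xy\in M'$, $i$ free, $jx,yi\in E$, replaces $M'$ by $(M'\setminus\{xy\})\cup\{jx,yi\}$; then $x$ and $y$ are each said to be reassigned once. Over the execution, each vertex of $L$ may be reassigned at most $s$ times and each vertex of $R$ at most $t$ times. A vertex is exhausted once it has reached its budget; an augmentation is feasible if every vertex it would reassign is not exhausted before it. A matched edge is frozen if one of its endpoints is exhausted.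 An algorithm is SP-Greedy for $\mathrm{OMP}_3(s,t)$ if, upon each arrival $j$, it augments along some feasible path of length 1 or 3 starting at $j$ whenever such a path exists (with no prescribed preference between them), and otherwise leaves $j$ unmatched. An augmenting path of length 3 for $M$ with middle edge $xy$ is a path $[j~x~y~i]$ with $j\in R$, $i\in L$ free in $M$, $jx,yi\in E$, $xy\in M$ (feasibility is not required). -}

module Defs where

open import Data.Fin using (Fin; fromℕ<)
open import Data.Fin.Permutation using (Permutation′; _⟨$⟩ʳ_)
open import Data.Fin.Subset using (Subset; _∈_)
open import Data.List using (List; []; _∷_)
open import Data.Maybe using (Maybe; just; nothing)
open import Data.Nat using (ℕ; zero; suc; _≤_; _<_)
open import Data.Nat.Properties using (<⇒≤; ≤-refl)
open import Data.Product using (∃; ∃-syntax; _×_; _,_)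
open import Data.Unit using (⊤)
open import Data.Vec using (Vec; lookup; replicate; updateAt; _[_]≔_)
open import Relation.Binary.Construct.Add.Supremum.NonStrict _≤_ using (_≤⁺_)
open import Relation.Binary.PropositionalEquality using (_≡_)
open import Relation.Nullary using (¬_)
open import Relation.Nullary.Construct.Add.Supremum using (_⁺; [_])

-- ⊤⁺ is the infinite budget.
ℕ∞ : Set
ℕ∞ = ℕ ⁺

-- L = Fin m and R = Fin n; the k-th vertex to arrive is order ⟨$⟩ʳ k.
record Instance (m n : ℕ) : Set where
  field
    nbr   : Fin n → Subset m
    order : Permutation′ n

  Edge : Fin m → Fin n → Set
  Edge x y = x ∈ nbr y

open Instance public using (Edge)

-- The partner of each online vertex.  That partners are adjacent and that
-- no offline vertex occurs twice is not built in: both hold initially and are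
-- preserved by augmenting paths.
Matching : ℕ → ℕ → Set
Matching m n = Vec (Maybe (Fin m)) n

module _ {m n : ℕ} (M : Matching m n) where

  Matched : Fin m → Fin n → Set
  Matched x y = lookup M y ≡ just x

  FreeL : Fin m → Set
  FreeL i = ¬ (∃[ y ] Matched i y)

  FreeR : Fin n → Set
  FreeR j = ¬ (∃[ x ] Matched x j)

-- Paths [j i] and [j x y i], without their starting vertex j.
data Path (m n : ℕ) : Set where
  direct : (i : Fin m) → Path m n
  via    : (x : Fin m) (y : Fin n) (i : Fin m) → Path m n

-- The vertices of such a path are automatically distinct, since x and y are
-- matched while i and j are free.
Augmenting : ∀ {m n} → Instance m n → Matching m n → Fin n → Path m n → Set
Augmenting I M j (direct i)  =
  FreeR M j × Edge I i j × FreeL M i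
Augmenting I M j (via x y i) =
  FreeR M j × Edge I x j × Matched M x y × Edge I i y × FreeL M i

MiddleEdge : ∀ {m n} → Instance m n → Matching m n → Fin m → Fin n → Set
MiddleEdge I M x y = ∃[ j ] ∃[ i ] Augmenting I M j (via x y i)

HasFreeNeighborL : ∀ {m n} → Instance m n → Matching m n → Fin m → Set
HasFreeNeighborL I M x = ∃[ j ] (Edge I x j × FreeR M j)

HasFreeNeighborR : ∀ {m n} → Instance m n → Matching m n → Fin n → Set
HasFreeNeighborR I M y = ∃[ i ] (Edge I i y × FreeL M i)

-- reassignedL and reassignedR count the reassignments of each vertex so far.
record State (m n : ℕ) : Set where
  field
    matching    : Matching m n
    reassignedL : Vec ℕ m
    reassignedR : Vec ℕ n

open State public

initial : ∀ {m n} → State m n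
initial {m} {n} = record
  { matching    = replicate n nothing
  ; reassignedL = replicate m 0
  ; reassignedR = replicate n 0
  }

ExhaustedL : ∀ {m n} → ℕ∞ → State m n → Fin m → Set
ExhaustedL s σ x = s ≤⁺ [ lookup (reassignedL σ) x ]

ExhaustedR : ∀ {m n} → ℕ∞ → State m n → Fin n → Set
ExhaustedR t σ y = t ≤⁺ [ lookup (reassignedR σ) y ]

WithinBudget : ∀ {m n} → ℕ∞ → ℕ∞ → State m n → Path m n → Set
WithinBudget s t σ (direct i)  = ⊤
WithinBudget s t σ (via x y i) = ¬ ExhaustedL s σ x × ¬ ExhaustedR t σ y

Feasible : ∀ {m n} → ℕ∞ → ℕ∞ → Instance m n → State m n → Fin n → Path m n → Set
Feasible s t I σ j p = Augmenting I (matching σ) j p × WithinBudget s t σ p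

-- The path to augment along, or nothing to leave the arriving vertex unmatched.
Decision : ℕ → ℕ → Set
Decision m n = Maybe (Path m n)

perform : ∀ {m n} → Fin n → Decision m n → State m n → State m n
perform j nothing            σ = σ
perform j (just (direct i))  σ = record σ
  { matching = matching σ [ j ]≔ just i }
perform j (just (via x y i)) σ = record
  { matching    = matching σ [ j ]≔ just x [ y ]≔ just i
  ; reassignedL = updateAt (reassignedL σ) x suc
  ; reassignedR = updateAt (reassignedR σ) y suc
  }

-- The arrived vertices with their neighborhoods, most recent first.
History : ℕ → ℕ → Set
History m n = List (Fin n × Subset m)

-- An online algorithm decides about the head of the history.  Its own earlier
-- decisions are determined by the tails of the history.
Algorithm : ℕ → ℕ → Set
Algorithm m n = History m n → Decision m n

module _ {m n : ℕ} (A : Algorithm m n) (I : Instance m n) where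
  open Instance I using (nbr; order)

  arrival : (k : ℕ) → .(k < n) → Fin n
  arrival k k<n = order ⟨$⟩ʳ fromℕ< k<n

  history : (k : ℕ) → .(k ≤ n) → History m n
  history zero    _   = []
  history (suc k) k<n = (j , nbr j) ∷ history k (<⇒≤ k<n)
    where j = arrival k k<n

  decision : (k : ℕ) → .(k < n) → Decision m n
  decision k k<n = A (history (suc k) k<n)

  -- The state after the first k arrivals.
  state : (k : ℕ) → .(k ≤ n) → State m n
  state zero    _   = initial
  state (suc k) k<n =
    perform (arrival k k<n) (decision k k<n) (state k (<⇒≤ k<n))

  final : State m n
  final = state n ≤-refl

GreedyDecision : ∀ {m n} → ℕ∞ → ℕ∞ → Instance m n → State m n → Fin n →
                 Decision m n → Set
GreedyDecision s t I σ j (just p) = Feasible s t I σ j p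
GreedyDecision s t I σ j nothing  = ¬ ∃ (Feasible s t I σ j)

SPGreedy : ∀ {m n} → ℕ∞ → ℕ∞ → Algorithm m n → Set
SPGreedy {m} {n} s t A =
  (I : Instance m n) (k : ℕ) (k<n : k < n) →
  GreedyDecision s t I (state A I k (<⇒≤ k<n)) (arrival A I k k<n)
                 (decision A I k k<n)

{-# OPTIONS --safe #-}
-- Call an offline vertex x releasable if x is free, or if its partner y has a
-- free neighbor and neither x nor y is exhausted.  The key point is that
-- releasability propagates backwards in time: if y became the partner of x in
-- the current step, then either x was free before, or the step augmented along
-- [y x y' i'], and this very path shows that x was releasable through y' and i'.
-- Free vertices also stay free when going back in time.  So if xy were an
-- unfrozen middle edge of [j x y i] at the end, then x would have been
-- releasable when its neighbor j arrived, and the greedy algorithm would have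
-- matched j, which would then have remained matched.
module Submission where

open import Defs
open import Data.Nat using (ℕ; suc; _≤_; _<_; _≤′_; ≤′-refl; ≤′-step)
open import Data.Nat.Properties using (≤-refl; ≤-reflexive; ≤-trans; <⇒≤; n≤1+n; ≤⇒≤′)
open import Data.Fin using (Fin; toℕ; _≟_)
open import Data.Fin.Properties using (any?; toℕ<n; fromℕ<-toℕ)
open import Data.Fin.Permutation using (_⟨$⟩ʳ_; _⟨$⟩ˡ_; inverseʳ)
open import Data.Fin.Subset.Properties using (_∈?_)
open import Data.Maybe using (just; nothing)
open import Data.Maybe.Properties using (just-injective; ≡-dec)
open import Data.Product using (_×_; _,_; ∃; ∃-syntax)
open import Data.Sum using (_⊎_; inj₁; inj₂)
open import Data.Unit using (tt)
open import Data.Vec using (Vec; lookup; updateAt; _[_]≔_)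
open import Data.Vec.Properties
  using (lookup∘update; lookup∘update′; lookup∘updateAt; lookup∘updateAt′)
open import Function using (_∘_)
open import Relation.Binary.Construct.Add.Supremum.NonStrict _≤_ using ([_]; ≤⁺-trans)
open import Relation.Binary.PropositionalEquality
  using (_≡_; _≢_; refl; sym; trans; cong)
open import Relation.Nullary using (¬_; Dec; yes; no; ¬?; _×-dec_)

module _ {m n : ℕ} (M : Matching m n) where

  freeR≢matched : ∀ {j x y} → FreeR M j → Matched M x y → y ≢ j
  freeR≢matched free xy refl = free (_ , xy)

  freeL? : ∀ i → Dec (FreeL M i)
  freeL? i = ¬? (any? λ y → ≡-dec _≟_ (lookup M y) (just i))

  hasFreeNeighborR? : ∀ (I : Instance m n) y → Dec (HasFreeNeighborR I M y)
  hasFreeNeighborR? I y = any? λ i → (i ∈? Instance.nbr I y) ×-dec freeL? i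

lookup≤lookup∘updateAt-suc : ∀ {n} (v : Vec ℕ n) i k →
                             lookup v k ≤ lookup (updateAt v i suc) k
lookup≤lookup∘updateAt-suc v i k with k ≟ i
... | yes refl = ≤-trans (n≤1+n _) (≤-reflexive (sym (lookup∘updateAt k v)))
... | no k≢i   = ≤-reflexive (sym (lookup∘updateAt′ k i k≢i v))

module _ {m n : ℕ} (M : Matching m n) {j : Fin n} {x : Fin m} where

  matched-≔ : Matched (M [ j ]≔ just x) x j
  matched-≔ = lookup∘update j M (just x)

  matched-≔-≢ : ∀ {x′ y} → y ≢ j → Matched M x′ y → Matched (M [ j ]≔ just x) x′ y
  matched-≔-≢ y≢j = trans (lookup∘update′ y≢j M (just x))

  matched-≔⁻ : ∀ {x′ y} → Matched (M [ j ]≔ just x) x′ y →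
               (y ≡ j × x ≡ x′) ⊎ Matched M x′ y
  matched-≔⁻ {y = y} xy with y ≟ j
  ... | yes refl = inj₁ (refl , just-injective (trans (sym matched-≔) xy))
  ... | no y≢j   = inj₂ (trans (sym (lookup∘update′ y≢j M (just x))) xy)

module _ {m n : ℕ} (s t : ℕ∞) (I : Instance m n) where

  -- This is what feasibility of a path through `x` asks of the state apart from the arriving
  -- vertex. No `j` occurs, so the property can be followed through steps at which other vertices
  -- arrive.
  Releasable : State m n → Fin m → Set
  Releasable σ x = FreeL (matching σ) x ⊎
    (∃[ y ] ∃[ i ] (Matched (matching σ) x y × Edge I i y × FreeL (matching σ) i ×
                    WithinBudget s t σ (via x y i)))

  releasable⇒feasible : ∀ {σ x j} → Releasable σ x → Edge I x j →
                        FreeR (matching σ) j → ∃ (Feasible s t I σ j)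
  releasable⇒feasible (inj₁ free) xj freeⱼ = direct _ , (freeⱼ , xj , free) , tt
  releasable⇒feasible (inj₂ (y , i , xy , iy , freeᵢ , b)) xj freeⱼ =
    via _ y i , (freeⱼ , xj , xy , iy , freeᵢ) , b

  module _ {σ : State m n} {j : Fin n} where

    private
      M = matching σ

    matchedL-perform : ∀ d → GreedyDecision s t I σ j d → ∀ {x y} → Matched M x y →
                       ∃[ y′ ] Matched (matching (perform j d σ)) x y′
    matchedL-perform nothing _ xy = _ , xy
    matchedL-perform (just (direct i)) ((freeⱼ , _) , _) xy =
      _ , matched-≔-≢ M (freeR≢matched M freeⱼ xy) xy
    matchedL-perform (just (via x′ y′ i)) ((freeⱼ , _ , x′y′ , _) , _) {y = y} xy
      with y ≟ y′
    ... | no y≢y′ =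
      y , matched-≔-≢ (M [ j ]≔ _) y≢y′ (matched-≔-≢ M (freeR≢matched M freeⱼ xy) xy)
    -- Here `x` is `x′`, the one offline vertex that loses its partner. It moves to `j`, and this
    -- entry survives the later write at `y′` because `y′` was matched while `j` was free.
    ... | yes refl with refl ← just-injective (trans (sym xy) x′y′) =
      j , matched-≔-≢ (M [ j ]≔ _) (freeR≢matched M freeⱼ xy ∘ sym) (matched-≔ M)

    matchedR-perform : ∀ d → GreedyDecision s t I σ j d → ∀ {x y} → Matched M x y →
                       ∃[ x′ ] Matched (matching (perform j d σ)) x′ y
    matchedR-perform nothing _ xy = _ , xy
    matchedR-perform (just (direct i)) ((freeⱼ , _) , _) xy =
      _ , matched-≔-≢ M (freeR≢matched M freeⱼ xy) xy
    matchedR-perform (just (via x′ y′ i)) ((freeⱼ , _) , _) {y = y} xy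
      with y ≟ y′
    ... | no y≢y′ =
      _ , matched-≔-≢ (M [ j ]≔ _) y≢y′ (matched-≔-≢ M (freeR≢matched M freeⱼ xy) xy)
    ... | yes refl = i , matched-≔ (M [ j ]≔ _)

    freeL-perform⁻ : ∀ d → GreedyDecision s t I σ j d → ∀ {x} →
                     FreeL (matching (perform j d σ)) x → FreeL M x
    freeL-perform⁻ d g free (_ , xy) = free (matchedL-perform d g xy)

    freeR-perform⁻ : ∀ d → GreedyDecision s t I σ j d → ∀ {y} →
                     FreeR (matching (perform j d σ)) y → FreeR M y
    freeR-perform⁻ d g free (_ , xy) = free (matchedR-perform d g xy)

    -- The counters never decrease, so a vertex exhausted before the step is still exhausted after
    -- it.
    withinBudget-perform⁻ : ∀ d p → WithinBudget s t (perform j d σ) p →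
                            WithinBudget s t σ p
    withinBudget-perform⁻ d                    (direct _)    b = tt
    withinBudget-perform⁻ nothing              (via _ _ _)   b = b
    withinBudget-perform⁻ (just (direct _))    (via _ _ _)   b = b
    withinBudget-perform⁻ (just (via x′ y′ _)) (via x y _) (bx , by) =
      (λ ex → bx (≤⁺-trans ≤-trans ex [ lookup≤lookup∘updateAt-suc (reassignedL σ) x′ x ])) ,
      (λ ey → by (≤⁺-trans ≤-trans ey [ lookup≤lookup∘updateAt-suc (reassignedR σ) y′ y ]))

    matched-perform⁻ : ∀ d → GreedyDecision s t I σ j d → ∀ {x y} →
                       Matched (matching (perform j d σ)) x y →
                       Matched M x y ⊎ Releasable σ x
    matched-perform⁻ nothing _ xy = inj₁ xy
    matched-perform⁻ (just (direct i)) ((_ , _ , freeᵢ) , _) xy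
      with matched-≔⁻ M xy
    ... | inj₁ (_ , refl) = inj₂ (inj₁ freeᵢ)
    ... | inj₂ old        = inj₁ old
    matched-perform⁻ (just (via x′ y′ i)) ((_ , _ , x′y′ , iy′ , freeᵢ) , b) xy
      with matched-≔⁻ (M [ j ]≔ just x′) xy
    -- The write at `y′` came last and is undone first: its new edge goes to `i`, the free end of
    -- the path.
    ... | inj₁ (_ , refl) = inj₂ (inj₁ freeᵢ)
    ... | inj₂ xy′ with matched-≔⁻ M xy′
    -- The other new edge joins `x′` to `j`. The witness is the rest of the path just used, and its
    -- feasibility supplies the budgets `b` before the step.
    ...   | inj₁ (_ , refl) = inj₂ (inj₂ (y′ , i , x′y′ , iy′ , freeᵢ , b))
    ...   | inj₂ old        = inj₁ old

    -- If the edge to `y` predates the step, the same `y` and `i` serve as witnesses before it;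
    -- otherwise the creation of that edge already gives the claim.
    releasable-perform⁻ : ∀ d → GreedyDecision s t I σ j d → ∀ {x} →
                          Releasable (perform j d σ) x → Releasable σ x
    releasable-perform⁻ d g (inj₁ free) = inj₁ (freeL-perform⁻ d g free)
    releasable-perform⁻ d g (inj₂ (y , i , xy , iy , freeᵢ , b))
      with matched-perform⁻ d g xy
    ... | inj₂ r   = r
    ... | inj₁ old = inj₂ (y , i , old , iy , freeL-perform⁻ d g freeᵢ ,
                           withinBudget-perform⁻ d (via _ y i) b)

    -- Every augmentation matches its starting vertex, so the decision was `nothing`, and for
    -- `nothing` the greedy condition is the conclusion itself.
    freeR-perform⇒¬feasible : ∀ d → GreedyDecision s t I σ j d →
                              FreeR (matching (perform j d σ)) j →
                              ¬ ∃ (Feasible s t I σ j)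
    freeR-perform⇒¬feasible nothing g _ = g
    freeR-perform⇒¬feasible (just (direct i)) _ free _ = free (i , matched-≔ M)
    freeR-perform⇒¬feasible (just (via x y i)) ((freeⱼ , _ , xy , _) , _) free _ =
      free (x , matched-≔-≢ (M [ j ]≔ _) (freeR≢matched M freeⱼ xy ∘ sym) (matched-≔ M))

module _ {m n : ℕ} (A : Algorithm m n) (I : Instance m n) where

  state-backwards : (P : State m n → Set) →
    (∀ k (k<n : k < n) → P (state A I (suc k) k<n) → P (state A I k (<⇒≤ k<n))) →
    ∀ {k l} → k ≤′ l → (k≤n : k ≤ n) (l≤n : l ≤ n) →
    P (state A I l l≤n) → P (state A I k k≤n)
  -- The bounds `k≤n` and `l≤n` may be different proofs, but `state` takes its bound irrelevantly,
  -- so `p` already has the required type.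
  state-backwards P step ≤′-refl        k≤n l≤n p = p
  state-backwards P step (≤′-step k≤′l) k≤n l<n p =
    state-backwards P step k≤′l k≤n (<⇒≤ l<n) (step _ l<n p)

  arrival-surjective : ∀ j → ∃[ k ] ∃[ k<n ] arrival A I k k<n ≡ j
  arrival-surjective j = toℕ pos , toℕ<n pos ,
    trans (cong (order ⟨$⟩ʳ_) (fromℕ<-toℕ pos (toℕ<n pos))) (inverseʳ order)
    where
    open Instance I using (order)
    pos = order ⟨$⟩ˡ j

  module _ {s t : ℕ∞} (greedy : SPGreedy s t A) where

    final-releasable⇒¬freeNeighbor : ∀ {x} → Releasable s t I (final A I) x →
                                     ¬ HasFreeNeighborL I (matching (final A I)) x
    final-releasable⇒¬freeNeighbor {x} r (j , xj , freeⱼ)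
      with k , k<n , refl ← arrival-surjective j =
      -- Freeness of the arriving vertex is used on both sides of its step: afterwards to exclude an
      -- augmentation, before to start a feasible path.
      freeR-perform⇒¬feasible s t I (decision A I k k<n) (greedy I k k<n) free⁺
        (releasable⇒feasible s t I releasable xj
          (freeR-perform⁻ s t I (decision A I k k<n) (greedy I k k<n) free⁺))
      where
      free⁺ : FreeR (matching (state A I (suc k) k<n)) (arrival A I k k<n)
      free⁺ = state-backwards (λ σ → FreeR (matching σ) (arrival A I k k<n))
        (λ k′ k′<n → freeR-perform⁻ s t I (decision A I k′ k′<n) (greedy I k′ k′<n))
        (≤⇒≤′ k<n) k<n ≤-refl freeⱼ

      releasable : Releasable s t I (state A I k (<⇒≤ k<n)) x
      releasable = state-backwards (λ σ → Releasable s t I σ x)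
        (λ k′ k′<n → releasable-perform⁻ s t I (decision A I k′ k′<n) (greedy I k′ k′<n))
        (≤⇒≤′ (<⇒≤ k<n)) (<⇒≤ k<n) ≤-refl r

lemma8 : ∀ {m n : ℕ} (s t : ℕ∞) (I : Instance m n)
    (A : Algorithm m n) → SPGreedy s t A →
    let σ = final A I
        M = matching σ in
    ∀ (x : Fin m) (y : Fin n) → Matched M x y →
    ¬ ExhaustedL s σ x → ¬ ExhaustedR t σ y →
    ¬ MiddleEdge I M x y ×
    (¬ HasFreeNeighborL I M x ⊎ ¬ HasFreeNeighborR I M y)
lemma8 s t I A greedy x y xy bx by = not-middle , one-side
  where
  M = matching (final A I)

  not-both : HasFreeNeighborR I M y → ¬ HasFreeNeighborL I M x
  not-both (i , iy , freeᵢ) = final-releasable⇒¬freeNeighbor A I greedy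
    (inj₂ (y , i , xy , iy , freeᵢ , bx , by))

  not-middle : ¬ MiddleEdge I M x y
  not-middle (j , i , freeⱼ , xj , _ , iy , freeᵢ) =
    not-both (i , iy , freeᵢ) (j , xj , freeⱼ)

  one-side : ¬ HasFreeNeighborL I M x ⊎ ¬ HasFreeNeighborR I M y
  -- A constructive disjunction requires a decision. Finiteness makes the existence of a free
  -- neighbor of `y` decidable.
  one-side with hasFreeNeighborR? M I y
  ... | yes fr = inj₁ (not-both fr)
  ... | no ¬fr = inj₂ ¬fr
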